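{- For all integers $k\ge 2$, $1\leq \ell\leq k-1$ and $1\leq m\leq \lfloor\frac{k}{k-\ell}\rfloor$, we have \[\hat{R}_r\big(P^{(k,\ell)}_{\ell+(m+1)(k-\ell)}\big)=\Theta_{m,k}(r^{m}),\] i.e. there are constants $c,C>0$ depending only on $m$ and $k$ (and $\ell$) such that $c\,r^m\le \hat{R}_r(P^{(k,\ell)}_{\ell+(m+1)(k-\ell)})\le C\,r^m$ for all sufficiently large $r$. In particular, when $\ell=k-1$: for all $1\leq m\leq k$, $\hat{R}_r(P^{(k)}_{k+m})=\Theta_{m,k}(r^{m})$.
   Context: A $k$-graph is a $k$-uniform hypergraph. For hypergraphs $G,H$ and an integer $r\ge 1$, $G\to_r H$ means that every $r$-coloring of the edges of $G$ contains a monochromatic copy of $H$. For a $k$-graph $H$, the $r$-color size-Ramsey number $\hat R_r(H)$ is the minimum number of edges of a $k$-graph $G$ with $G\to_r H$. For $1\le \ell\le k-1$ and $m\ge 1$, the $k$-uniform $\ell$-overlapping path (or $(k,\ell)$-path) with $m$ edges is the $k$-graph with vertex set $\{v_1,\dots,v_{k+(m-1)(k-\ell)}\}$ and edges $\{v_{(i-1)(k-\ell)+1},\dots,v_{(i-1)(k-\ell)+k}\}$ for $i\in[m]$; $P_n^{(k,\ell)}$ denotes the $(k,\ell)$-path with $n$ vertices. $P_n^{(k)}:=P_n^{(k,k-1)}$ is the tight path. -}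

module Defs where

open import Data.Nat using (ℕ; _+_; _*_; _∸_; _≤ᵇ_; _<ᵇ_)
open import Data.Bool using (_∧_)
open import Data.Fin using (Fin; toℕ)
open import Data.Fin.Subset using (Subset; _∈_; ∣_∣)
open import Data.List using (List; length; map; upTo)
open import Data.List.Relation.Unary.All using (All)
open import Data.List.Relation.Unary.Unique.Propositional using (Unique)
open import Data.List.Membership.Propositional renaming (_∈_ to _∈ₗ_)
open import Data.Vec using (tabulate)
open import Data.Product using (Σ; ∃; _×_)
open import Relation.Binary.PropositionalEquality using (_≡_)
open import Function.Definitions using (Injective)

record KGraph (k : ℕ) : Set where
  field
    n       : ℕ
    E       : List (Subset n)
    uniform : All (λ e → ∣ e ∣ ≡ k) E
    simple  : Unique E
open KGraph public

edgeCount : ∀ {k} → KGraph k → ℕ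
edgeCount G = length (E G)

IsImage : ∀ {p n} → (Fin p → Fin n) → Subset p → Subset n → Set
IsImage {p} φ e f =
  ∀ i → (i ∈ f → Σ (Fin p) λ j → j ∈ e × φ j ≡ i)
      × ((Σ (Fin p) λ j → j ∈ e × φ j ≡ i) → i ∈ f)

MonoCopy : ∀ {k} (G : KGraph k) (r : ℕ) → (Subset (n G) → Fin r) →
           (p : ℕ) → List (Subset p) → Set
MonoCopy G r col p EH =
  Σ (Fin p → Fin (n G)) λ φ → Injective _≡_ _≡_ φ ×
    Σ (Fin r) λ c →
      All (λ e → Σ (Subset (n G)) λ f → f ∈ₗ E G × IsImage φ e f × col f ≡ c) EH

-- G →_r H : every r-colouring of the edges of G has a monochromatic copy of H.
-- (A colouring is a map on subsets; only its values on edges of G matter.)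
Arrows : ∀ {k} (G : KGraph k) (r : ℕ) (p : ℕ) → List (Subset p) → Set
Arrows G r p EH = (col : Subset (n G) → Fin r) → MonoCopy G r col p EH

-- The (k,ℓ)-path with M ≥ 1 edges: vertices v_1..v_N (here 0..N-1) with
-- N = k + (M-1)(k-ℓ), edges {i(k-ℓ), ..., i(k-ℓ)+k-1} for i = 0..M-1.
pathOrder : ℕ → ℕ → ℕ → ℕ
pathOrder k ℓ M = k + (M ∸ 1) * (k ∸ ℓ)

pathEdge : (k ℓ N : ℕ) → ℕ → Subset N
pathEdge k ℓ N i =
  tabulate (λ j → (i * (k ∸ ℓ) ≤ᵇ toℕ j) ∧ (toℕ j <ᵇ i * (k ∸ ℓ) + k))

pathEdges : (k ℓ M : ℕ) → List (Subset (pathOrder k ℓ M))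
pathEdges k ℓ M = map (pathEdge k ℓ (pathOrder k ℓ M)) (upTo M)

{-# OPTIONS --safe #-}

-- Write d = k - ℓ. Since m d ≤ k, a vertex of the second but not of the first of m + 1 consecutive
-- edges of the path lies in all of them except the first.
--
-- Lower bound. Let s = ⌊ r / K ⌋ and call a vertex set heavy at level j if its degree is at least
-- s ^ j. A light set of level j + 1 lies in only O(s) heavy sets of level j, so one can colour the
-- edges with r colours such that consecutive edges e , e′ of a monochromatic path never satisfy
-- e′ = (e ∩ e′) ∪ B for a set B heavy at level j containing a subset of e light at level j + 1.
-- By induction on j the intersection of any j + 1 consecutive edges of a monochromatic path is
-- then heavy at level j, and j = m gives s ^ m ≤ |E|.
--
-- Upper bound. Blow up the complete m-partite m-graph with parts of size N = r m + 1 (d copies of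
-- each vertex, plus a common core): the path becomes a sequence of m + 1 tuples in [N]^m changing
-- the coordinates one after another. If x ∈ [N]^m is not the last vertex of a monochromatic such
-- sequence, there is a first coordinate j at which it gets stuck, and x is then determined by its
-- colour, j and its other coordinates, which leaves at most r m N ^ (m - 1) < N ^ m tuples.

module Submission where

open import Defs
open import Data.Bool using (Bool; true; false; if_then_else_)
import Data.Bool as Bool
open import Data.Bool.Properties using (T-≡; T-∧)
open import Data.Fin as Fin using (Fin; toℕ; _↑ˡ_; _↑ʳ_; combine; splitAt; remQuot; punchIn; funToFin; finToFun)
import Data.Fin.Properties as Finₚ
open import Data.Fin.Subset using (Subset; inside; outside; ⊤; _∈_; _⊆_; _∩_; _∪_; ∣_∣)
open import Data.Fin.Subset.Properties
  using (_⊆?_; _∈?_; ⊆-trans; ⊆-antisym; p∩q⊆p; p∩q⊆q; x∈p∩q⁺; x∈p∪q⁺; x∈p∪q⁻; ⊆⊤; drop-∷-⊆; ∣⊤∣≡n; ∣⊥∣≡0)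
import Data.List as List
open import Data.List using (List; []; _∷_; length; filter; concatMap; upTo)
open import Data.List.Membership.Propositional using (lose; find) renaming (_∈_ to _∈ₗ_; _∉_ to _∉ₗ_)
open import Data.List.Membership.Propositional.Properties
  using (∈-map⁺; ∈-map⁻; ∈-++⁺ˡ; ∈-++⁺ʳ; ∈-filter⁺; ∈-filter⁻; ∈-concatMap⁺; ∈-upTo⁺; ∈-upTo⁻; ∈-allFin)
import Data.List.Membership.DecPropositional as DecMembership
open import Data.List.Properties
  using (length-map; length-++; length-upTo; length-tabulate; length-filter; filter-notAll; filter-some)
import Data.List.Relation.Unary.All as All
import Data.List.Relation.Unary.All.Properties as Allₚ
open import Data.List.Relation.Unary.AllPairs using ([]; _∷_)
open import Data.List.Relation.Unary.Any as Any using (here; there; any?)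
open import Data.List.Relation.Unary.Any.Properties using (lookup-index)
open import Data.List.Relation.Unary.Unique.Propositional using (Unique)
import Data.List.Relation.Unary.Unique.Propositional.Properties as Uniqueₚ
open import Data.Nat
open import Data.Nat.DivMod using (m≡m%n+[m/n]*n; m%n<n; m/n*n≤m; m≥n⇒m/n>0)
open import Data.Nat.ListAction using (sum)
open import Data.Nat.Properties
open import Data.Nat.Tactic.RingSolver using (solve-∀)
open import Data.Product using (Σ; ∃; _×_; _,_; proj₁; proj₂; uncurry; map₂)
open import Data.Sum using (_⊎_; inj₁; inj₂; [_,_]′)
open import Data.Unit using (tt) renaming (⊤ to Unit)
open import Data.Vec using (Vec; []; _∷_; _++_; concat; map; replicate; here; there; lookup; tabulate; _[_]≔_)
import Data.Vec.Properties as Vecₚ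
open import Function using (_∘_; id; Equivalence)
open import Function.Definitions using (Injective)
open import Relation.Binary using (Decidable; DecidableEquality)
open import Relation.Binary.PropositionalEquality
open import Relation.Nullary using (¬_; yes; no; does; _because_; ¬?; contradiction; _×-dec_)
open import Relation.Nullary.Decidable using (dec-true; dec-false)
import Relation.Unary as U

-- Counting in lists

module _ {A B : Set} {R : A → B → Set} (R? : Decidable R) where

  private
    row : List B → A → ℕ
    row ys x = length (filter (R? x) ys)

    column : List A → B → ℕ
    column xs y = length (filter (λ x → R? x y) xs)

    swap : ∀ a b c → a + (b + c) ≡ b + (a + c)
    swap = solve-∀

    sum-column-∷ : ∀ x xs ys →
      sum (List.map (column (x ∷ xs)) ys) ≡ row ys x + sum (List.map (column xs) ys)
    sum-column-∷ x xs [] = refl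
    sum-column-∷ x xs (y ∷ ys) with ih ← sum-column-∷ x xs ys | does (R? x y)
    ... | true = cong suc (trans (cong (column xs y +_) ih) (swap (column xs y) (row ys x) _))
    ... | false = trans (cong (column xs y +_) ih) (swap (column xs y) (row ys x) _)

    sum-≤ : ∀ {f : B → ℕ} {d} ys → (∀ {y} → y ∈ₗ ys → f y ≤ d) → sum (List.map f ys) ≤ length ys * d
    sum-≤ []       f≤d = z≤n
    sum-≤ (y ∷ ys) f≤d = +-mono-≤ (f≤d (here refl)) (sum-≤ ys (f≤d ∘ there))

    rows≤columns : ∀ {c} xs ys → (∀ {x} → x ∈ₗ xs → c ≤ row ys x) →
      length xs * c ≤ sum (List.map (column xs) ys)
    rows≤columns []       ys c≤ = z≤n
    rows≤columns (x ∷ xs) ys c≤ = ≤-trans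
      (+-mono-≤ (c≤ (here refl)) (rows≤columns xs ys (c≤ ∘ there)))
      (≤-reflexive (sym (sum-column-∷ x xs ys)))

  double-counting : ∀ {c d} xs ys →
    (∀ {x} → x ∈ₗ xs → c ≤ length (filter (R? x) ys)) →
    (∀ {y} → y ∈ₗ ys → length (filter (λ x → R? x y) xs) ≤ d) →
    length xs * c ≤ length ys * d
  double-counting xs ys c≤ ≤d = ≤-trans (rows≤columns xs ys c≤) (sum-≤ ys ≤d)

length-concatMap-≤ : ∀ {A B : Set} (f : A → List B) {d} xs →
  (∀ {x} → x ∈ₗ xs → length (f x) ≤ d) → length (concatMap f xs) ≤ length xs * d
length-concatMap-≤ f []       f≤d = z≤n
length-concatMap-≤ f (x ∷ xs) f≤d = ≤-trans (≤-reflexive (length-++ (f x)))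
  (+-mono-≤ (f≤d (here refl)) (length-concatMap-≤ f xs (f≤d ∘ there)))

∈-concatMap : ∀ {A B : Set} (f : A → List B) {x y xs} → x ∈ₗ xs → y ∈ₗ f x → y ∈ₗ concatMap f xs
∈-concatMap f x∈xs y∈fx = ∈-concatMap⁺ f (lose x∈xs y∈fx)

length-filter-filter : ∀ {A : Set} {P Q : A → Set} (P? : U.Decidable P) (Q? : U.Decidable Q) →
  (∀ {x} → P x → Q x) → ∀ xs → length (filter P? xs) ≤ length (filter P? (filter Q? xs))
length-filter-filter P? Q? P⇒Q [] = z≤n
length-filter-filter P? Q? P⇒Q (x ∷ xs) with ih ← length-filter-filter P? Q? P⇒Q xs | P? x | Q? x
... | no  _  | false because _ = ih
... | yes px | no ¬qx = contradiction (P⇒Q px) ¬qx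
... | no ¬px | yes _ with P? x
...   | yes px = contradiction px ¬px
...   | no  _  = ih
length-filter-filter P? Q? P⇒Q (x ∷ xs) | yes px | yes _ with P? x
...   | yes _  = s≤s ih
...   | no ¬px = contradiction px ¬px

-- If every colour occurred in `cs`, sending a colour to its position would inject `Fin r` into
-- `Fin (length cs)`.
fresh : ∀ {r} (cs : List (Fin r)) → length cs < r → ∃ λ c → c ∉ₗ cs
fresh {r} cs cs<r with Finₚ.any? (λ c → ¬? (DecMembership._∈?_ Finₚ._≟_ c cs))
... | yes found = found
... | no  none  = contradiction (Finₚ.injective⇒≤ position-injective) (<⇒≱ cs<r)
  where
  all∈ : ∀ c → c ∈ₗ cs
  all∈ c with DecMembership._∈?_ Finₚ._≟_ c cs
  ... | yes c∈cs = c∈cs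
  ... | no  c∉cs = contradiction (c , c∉cs) none
  position-injective : ∀ {c c′} → Any.index (all∈ c) ≡ Any.index (all∈ c′) → c ≡ c′
  position-injective {c} {c′} eq = trans (lookup-index (all∈ c))
    (trans (cong (List.lookup cs) eq) (sym (lookup-index (all∈ c′))))

-- Greedy colouring of digraphs of bounded out-degree

module _ {V : Set} (_≟ⱽ_ : DecidableEquality V) where

  open DecMembership _≟ⱽ_ using () renaming (_∈?_ to _∈ₗ?_)

  unique-length-≤ : ∀ {xs ys : List V} → Unique xs → (∀ {x} → x ∈ₗ xs → x ∈ₗ ys) → length xs ≤ length ys
  unique-length-≤ [] _ = z≤n
  unique-length-≤ {x ∷ xs} {ys} (x∉xs ∷ xs!) xs⊆ys = <-≤-trans
    (s≤s (unique-length-≤ xs! λ y∈xs →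
      ∈-filter⁺ (¬? ∘ (x ≟ⱽ_)) (xs⊆ys (there y∈xs)) (All.lookup x∉xs y∈xs)))
    (filter-notAll (¬? ∘ (x ≟ⱽ_)) ys (Any.map (λ x≡y x≢y → x≢y x≡y) (xs⊆ys (here refl))))

  -- The average in-degree is at most Δ, so the digraph and all its restrictions have a vertex
  -- of total degree at most 2Δ, and greedy colouring in the reverse removal order succeeds.
  module _ (out : V → List V) (Δ : ℕ) where

    private
      inNeighbours : List V → V → List V
      inNeighbours L v = filter (λ u → v ∈ₗ? out u) L

    small-in-degree : ∀ {L} → Unique L → (∀ {v} → v ∈ₗ L → length (out v) ≤ Δ) → 0 < length L →
      ∃ λ v → v ∈ₗ L × length (inNeighbours L v) ≤ Δ
    small-in-degree {L} L! out≤Δ L≢[] with any? (λ v → length (inNeighbours L v) ≤? Δ) L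
    ... | yes found = find found
    ... | no  none  = contradiction counted (<⇒≱ (*-monoʳ-< (length L) {{>-nonZero L≢[]}} ≤-refl))
      where
      counted : length L * suc Δ ≤ length L * Δ
      counted = double-counting (λ v u → v ∈ₗ? out u) L L
        (λ v∈L → ≰⇒> (All.lookup (Allₚ.¬Any⇒All¬ L none) v∈L))
        (λ {u} u∈L → ≤-trans
          (unique-length-≤ (Uniqueₚ.filter⁺ (_∈ₗ? out u) L!) (proj₂ ∘ ∈-filter⁻ (_∈ₗ? out u) {xs = L}))
          (out≤Δ u∈L))

    out-colouring : ∀ {r} → Δ + Δ < r → ∀ n L → length L ≤ n → Unique L →
      (∀ {v} → v ∈ₗ L → length (out v) ≤ Δ) →
      Σ (V → Fin r) λ col → ∀ {u v} → u ∈ₗ L → v ∈ₗ L → v ∈ₗ out u → u ≢ v → col u ≢ col v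
    out-colouring {suc r} _ _ [] _ _ _ = (λ _ → Fin.zero) , λ ()
    -- The recursion runs on the bound `n`, since deleting `w` by `filter` does not give a
    -- structurally smaller list.
    out-colouring {r} 2Δ<r (suc n) L@(_ ∷ _) L≤n L! out≤Δ
      with w , w∈L , in≤Δ ← small-in-degree L! out≤Δ z<s
      with col , proper ← out-colouring 2Δ<r n (filter (¬? ∘ (w ≟ⱽ_)) L)
             (≤-pred (≤-trans (filter-notAll (¬? ∘ (w ≟ⱽ_)) L (Any.map (λ w≡y w≢y → w≢y w≡y) w∈L)) L≤n))
             (Uniqueₚ.filter⁺ (¬? ∘ (w ≟ⱽ_)) L!) (out≤Δ ∘ proj₁ ∘ ∈-filter⁻ (¬? ∘ (w ≟ⱽ_)))
      -- `w` must avoid the colours of its out-neighbours and of its in-neighbours within `L`, at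
      -- most `Δ + Δ` in total.
      with c , c∉ ← fresh (List.map col (out w) List.++ List.map col (inNeighbours L w))
             (≤-<-trans (≤-trans (≤-reflexive (trans (length-++ (List.map col (out w)))
               (cong₂ _+_ (length-map col (out w)) (length-map col (inNeighbours L w)))))
               (+-mono-≤ (out≤Δ w∈L) in≤Δ)) 2Δ<r)
      = col′ , proper′
      where
      col′ : V → Fin r
      col′ v with w ≟ⱽ v
      ... | yes _ = c
      ... | no  _ = col v
      proper′ : ∀ {u v} → u ∈ₗ L → v ∈ₗ L → v ∈ₗ out u → u ≢ v → col′ u ≢ col′ v
      proper′ {u} {v} u∈L v∈L v∈out u≢v with w ≟ⱽ u | w ≟ⱽ v
      ... | yes refl | yes refl = contradiction refl u≢v
      ... | yes refl | no  _    = λ c≡ → c∉ (∈-++⁺ˡ (subst (_∈ₗ List.map col (out w)) (sym c≡) (∈-map⁺ col v∈out)))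
      ... | no  _    | yes refl = λ ≡c → c∉ (∈-++⁺ʳ (List.map col (out w))
              (subst (_∈ₗ List.map col (inNeighbours L w)) ≡c (∈-map⁺ col (∈-filter⁺ (λ x → w ∈ₗ? out x) u∈L v∈out))))
      ... | no  w≢u  | no  w≢v  = proper (∈-filter⁺ (¬? ∘ (w ≟ⱽ_)) u∈L w≢u)
              (∈-filter⁺ (¬? ∘ (w ≟ⱽ_)) v∈L w≢v) v∈out u≢v

-- Subsets

_≟ˢ_ : ∀ {n} → DecidableEquality (Subset n)
_≟ˢ_ = Vecₚ.≡-dec Bool._≟_

powerset : ∀ {n} → Subset n → List (Subset n)
powerset []            = [] ∷ []
powerset (outside ∷ e) = List.map (outside ∷_) (powerset e)
powerset (inside  ∷ e) = List.map (outside ∷_) (powerset e) List.++ List.map (inside ∷_) (powerset e)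

length-powerset : ∀ {n} (e : Subset n) → length (powerset e) ≡ 2 ^ ∣ e ∣
length-powerset []            = refl
length-powerset (outside ∷ e) = trans (length-map _ (powerset e)) (length-powerset e)
length-powerset (inside  ∷ e) = begin
  length (List.map (outside ∷_) (powerset e) List.++ List.map (inside ∷_) (powerset e))
    ≡⟨ length-++ (List.map (outside ∷_) (powerset e)) ⟩
  length (List.map (outside ∷_) (powerset e)) + length (List.map (inside ∷_) (powerset e))
    ≡⟨ cong₂ _+_ (length-map _ (powerset e)) (length-map _ (powerset e)) ⟩
  length (powerset e) + length (powerset e)
    ≡⟨ cong₂ _+_ (length-powerset e) (trans (length-powerset e) (sym (+-identityʳ _))) ⟩
  2 ^ ∣ inside ∷ e ∣ ∎
  where open ≡-Reasoning

∈-powerset : ∀ {n} {q e : Subset n} → q ⊆ e → q ∈ₗ powerset e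
∈-powerset {q = []}          {[]}          q⊆e = here refl
∈-powerset {q = outside ∷ q} {outside ∷ e} q⊆e = ∈-map⁺ _ (∈-powerset (drop-∷-⊆ q⊆e))
∈-powerset {q = inside  ∷ q} {outside ∷ e} q⊆e = contradiction (q⊆e here) λ ()
∈-powerset {q = outside ∷ q} {inside  ∷ e} q⊆e = ∈-++⁺ˡ (∈-map⁺ _ (∈-powerset (drop-∷-⊆ q⊆e)))
∈-powerset {q = inside  ∷ q} {inside  ∷ e} q⊆e =
  ∈-++⁺ʳ (List.map (outside ∷_) (powerset e)) (∈-map⁺ _ (∈-powerset (drop-∷-⊆ q⊆e)))

powerset-unique : ∀ {n} (e : Subset n) → Unique (powerset e)
powerset-unique []            = All.[] ∷ []
powerset-unique (outside ∷ e) = Uniqueₚ.map⁺ Vecₚ.∷-injectiveʳ (powerset-unique e)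
powerset-unique (inside  ∷ e) = Uniqueₚ.++⁺
  (Uniqueₚ.map⁺ Vecₚ.∷-injectiveʳ (powerset-unique e))
  (Uniqueₚ.map⁺ Vecₚ.∷-injectiveʳ (powerset-unique e))
  λ (∈out , ∈in) → disjoint ∈out ∈in
  where
  disjoint : ∀ {n} {v : Subset (suc n)} {ps qs} →
    v ∈ₗ List.map (outside ∷_) ps → v ∉ₗ List.map (inside ∷_) qs
  disjoint ∈out ∈in with _ , _ , refl ← ∈-map⁻ _ ∈out with _ , _ , () ← ∈-map⁻ _ ∈in

-- Heavy and light sets, and the conflict digraph

module Conflict {k} (G : KGraph k) (s m : ℕ) .{{_ : NonZero s}} where

  degree : Subset (n G) → ℕ
  degree q = length (filter (q ⊆?_) (E G))

  HeavyAbove : ℕ → Subset (n G) → Subset (n G) → Set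
  HeavyAbove j q B = q ⊆ B × s ^ j ≤ degree B

  heavyAbove? : ∀ j q → U.Decidable (HeavyAbove j q)
  heavyAbove? j q B = q ⊆? B ×-dec s ^ j ≤? degree B

  heavies : ℕ → Subset (n G) → List (Subset (n G))
  heavies j q = filter (heavyAbove? j q) (powerset ⊤)

  lights : ℕ → Subset (n G) → List (Subset (n G))
  lights j e = filter (λ q → degree q <? s ^ suc j) (powerset e)

  -- In a monochromatic path with consecutive edges e and e′, the role of q is played by an
  -- intersection of j + 2 consecutive edges starting at e, and that of B by the intersection
  -- of the last j + 1 of them, so that e′ = (e ∩ e′) ∪ B.
  conflicts : Subset (n G) → List (Subset (n G))
  conflicts e = concatMap (λ j → concatMap (λ q → concatMap (λ B → List.map (_∪ B) (powerset e))
    (heavies j q)) (lights j e)) (upTo m)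

  -- Count pairs `B ⊆ f` with `B` heavy above `q` and `f` an edge containing `q`. Each `B` lies in
  -- at least `s ^ j` such edges, and each `f` has only `2 ^ k` subsets.
  length-heavies : ∀ j q → degree q ≤ s ^ suc j → length (heavies j q) ≤ s * 2 ^ k
  length-heavies j q light = *-cancelʳ-≤ _ _ (s ^ j) {{m^n≢0 s j}} (begin
    length (heavies j q) * s ^ j
      ≤⟨ double-counting _⊆?_ (heavies j q) (filter (q ⊆?_) (E G)) rows columns ⟩
    degree q * 2 ^ k      ≤⟨ *-monoˡ-≤ (2 ^ k) light ⟩
    s * s ^ j * 2 ^ k     ≡⟨ swap s (s ^ j) (2 ^ k) ⟩
    s * 2 ^ k * s ^ j     ∎)
    where
    open ≤-Reasoning
    swap : ∀ a b c → a * b * c ≡ a * c * b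
    swap = solve-∀
    rows : ∀ {B} → B ∈ₗ heavies j q → s ^ j ≤ length (filter (B ⊆?_) (filter (q ⊆?_) (E G)))
    rows B∈ with _ , q⊆B , heavy ← ∈-filter⁻ (heavyAbove? j q) {xs = powerset ⊤} B∈ =
      ≤-trans heavy (length-filter-filter _ _ (⊆-trans q⊆B) (E G))
    columns : ∀ {f} → f ∈ₗ filter (q ⊆?_) (E G) → length (filter (_⊆? f) (heavies j q)) ≤ 2 ^ k
    columns {f} f∈ = ≤-trans
      (unique-length-≤ _≟ˢ_
        (Uniqueₚ.filter⁺ (_⊆? f) (Uniqueₚ.filter⁺ (heavyAbove? j q) (powerset-unique ⊤)))
        (∈-powerset ∘ proj₂ ∘ ∈-filter⁻ (_⊆? f) {xs = heavies j q}))
      (≤-reflexive (trans (length-powerset f)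
        (cong (2 ^_) (All.lookup (uniform G) (proj₁ (∈-filter⁻ (q ⊆?_) {xs = E G} f∈))))))

  -- The factors count the levels `j`, the light sets `q ⊆ e`, the heavy sets `B` above `q`, and the
  -- candidates for `e ∩ e′`. The bound is linear in `s`, so `s` may be a constant fraction of `r`.
  length-conflicts : ∀ {e} → ∣ e ∣ ≡ k → length (conflicts e) ≤ m * (2 ^ k * (s * 2 ^ k * 2 ^ k))
  length-conflicts {e} ∣e∣≡k = ≤-trans (length-concatMap-≤ _ (upTo m) λ {j} _ →
      ≤-trans (length-concatMap-≤ _ (lights j e) λ {q} q∈ →
        ≤-trans (length-concatMap-≤ _ (heavies j q) λ {B} _ →
          ≤-reflexive (trans (length-map (_∪ B) (powerset e)) length-powerset-e))
        (*-monoˡ-≤ (2 ^ k) (length-heavies j q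
          (<⇒≤ (proj₂ (∈-filter⁻ (λ q → degree q <? s ^ suc j) {xs = powerset e} q∈))))))
      (*-monoˡ-≤ _ (≤-trans (length-filter _ (powerset e)) (≤-reflexive length-powerset-e))))
    (≤-reflexive (cong (_* _) (length-upTo m)))
    where
    length-powerset-e : length (powerset e) ≡ 2 ^ k
    length-powerset-e = trans (length-powerset e) (cong (2 ^_) ∣e∣≡k)

  ∈-conflicts : ∀ {e e′ q B} j → j < m → q ⊆ e → degree q < s ^ suc j → HeavyAbove j q B →
    e′ ≡ (e ∩ e′) ∪ B → e′ ∈ₗ conflicts e
  ∈-conflicts {e} {e′} {q} {B} j j<m q⊆e light heavy eq =
    ∈-concatMap _ (∈-upTo⁺ j<m)
      (∈-concatMap _ (∈-filter⁺ (λ q → degree q <? s ^ suc j) (∈-powerset q⊆e) light)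
        (∈-concatMap _ (∈-filter⁺ (heavyAbove? j q) (∈-powerset ⊆⊤) heavy)
          (subst (_∈ₗ List.map (_∪ B) (powerset e)) (sym eq) (∈-map⁺ (_∪ B) (∈-powerset (p∩q⊆p e e′))))))

  intersection : (ℕ → Subset (n G)) → ℕ → ℕ → Subset (n G)
  intersection f i zero    = f i
  intersection f i (suc j) = f i ∩ intersection f (suc i) j

  intersection⊆ : ∀ f i j → intersection f i j ⊆ f i
  intersection⊆ f i zero    = id
  intersection⊆ f i (suc j) = p∩q⊆p (f i) _

  ∈-intersection : ∀ {x} f i j → (∀ t → t ≤ j → x ∈ f (i + t)) → x ∈ intersection f i j
  ∈-intersection {x} f i zero    x∈ = subst (λ i → x ∈ f i) (+-identityʳ i) (x∈ 0 z≤n)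
  ∈-intersection {x} f i (suc j) x∈ = x∈p∩q⁺
    ( subst (λ i → x ∈ f i) (+-identityʳ i) (x∈ 0 z≤n)
    , ∈-intersection f (suc i) j λ t t≤j → subst (λ i → x ∈ f i) (+-suc i t) (x∈ (suc t) (s≤s t≤j)))

  degree-edge : ∀ {e} → e ∈ₗ E G → 1 ≤ degree e
  degree-edge {e} e∈E = filter-some (e ⊆?_) (lose e∈E id)

  module _ (f : ℕ → Subset (n G))
    (edge       : ∀ i → i ≤ m → f i ∈ₗ E G)
    (persistent : ∀ i t {x} → i + suc t ≤ m → x ∈ f (suc i) → ¬ x ∈ f i → x ∈ f (i + suc t))
    (free       : ∀ i → i < m → ¬ f (suc i) ∈ₗ conflicts (f i))
    where

    -- Induction on `j`. Let `B` be the intersection of the `j + 1` edges from `f (suc i)` on, heavy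
    -- by induction. By `persistent`, the vertices of `f (suc i)` outside `f i` all lie in `B`. If
    -- `f i ∩ B` were light at level `suc j`, then `f (suc i)` would be a conflict of `f i`, against
    -- `free`.
    intersection-heavy : ∀ j i → i + j ≤ m → s ^ j ≤ degree (intersection f i j)
    intersection-heavy zero    i i≤m = degree-edge (edge i (subst (_≤ m) (+-identityʳ i) i≤m))
    intersection-heavy (suc j) i i+j≤m with s ^ suc j ≤? degree (intersection f i (suc j))
    ... | yes heavy = heavy
    ... | no  light = contradiction
      (∈-conflicts j (≤-trans (m≤n+m (suc j) i) i+j≤m)
        (intersection⊆ f i (suc j)) (≰⇒> light)
        (p∩q⊆q (f i) _ , intersection-heavy j (suc i) (subst (_≤ m) (+-suc i j) i+j≤m))
        (⊆-antisym split merge))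
      (free i (<-≤-trans (m<m+n i z<s) i+j≤m))
      where
      split : f (suc i) ⊆ (f i ∩ f (suc i)) ∪ intersection f (suc i) j
      split {x} x∈ with x ∈? f i
      ... | yes x∈fi = x∈p∪q⁺ (inj₁ (x∈p∩q⁺ (x∈fi , x∈)))
      ... | no  x∉fi = x∈p∪q⁺ (inj₂ (∈-intersection f (suc i) j λ t t≤j →
        subst (λ i → x ∈ f i) (+-suc i t)
          (persistent i t (≤-trans (+-monoʳ-≤ i (s≤s t≤j)) i+j≤m) x∈ x∉fi)))
      merge : (f i ∩ f (suc i)) ∪ intersection f (suc i) j ⊆ f (suc i)
      merge x∈ with x∈p∪q⁻ (f i ∩ f (suc i)) _ x∈
      ... | inj₁ x∈∩ = p∩q⊆q (f i) _ x∈∩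
      ... | inj₂ x∈I = intersection⊆ f (suc i) j x∈I

    edge-bound : s ^ m ≤ edgeCount G
    edge-bound = ≤-trans (intersection-heavy m 0 ≤-refl) (length-filter _ (E G))

-- Paths

lookup⇒∈ : ∀ {n} {x : Fin n} {p : Subset n} → lookup p x ≡ true → x ∈ p
lookup⇒∈ {x = x} {p} = Vecₚ.lookup⇒[]= x p

∈-tabulate⁺ : ∀ {n} {g : Fin n → Bool} {v} → g v ≡ true → v ∈ tabulate g
∈-tabulate⁺ {g = g} {v} gv = lookup⇒∈ (trans (Vecₚ.lookup∘tabulate g v) gv)

∈-tabulate⁻ : ∀ {n} {g : Fin n → Bool} {v} → v ∈ tabulate g → g v ≡ true
∈-tabulate⁻ {g = g} {v} v∈ = trans (sym (Vecₚ.lookup∘tabulate g v)) (Vecₚ.[]=⇒lookup v∈)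

module _ (k ℓ N i : ℕ) {v : Fin N} where

  ∈-pathEdge⁺ : i * (k ∸ ℓ) ≤ toℕ v → toℕ v < i * (k ∸ ℓ) + k → v ∈ pathEdge k ℓ N i
  ∈-pathEdge⁺ lower upper = ∈-tabulate⁺
    (Equivalence.to T-≡ (Equivalence.from T-∧ (≤⇒≤ᵇ lower , <⇒<ᵇ upper)))

  ∈-pathEdge⁻ : v ∈ pathEdge k ℓ N i → i * (k ∸ ℓ) ≤ toℕ v × toℕ v < i * (k ∸ ℓ) + k
  ∈-pathEdge⁻ v∈ with lower , upper ← Equivalence.to T-∧ (Equivalence.from T-≡ (∈-tabulate⁻ v∈)) =
    ≤ᵇ⇒≤ _ _ lower , <ᵇ⇒< _ _ upper

extend : ∀ {A : Set} {P : ℕ → A → Set} {m} → (∀ i → i ≤ m → ∃ (P i)) →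
  Σ (ℕ → A) λ f → ∀ i → i ≤ m → P i (f i)
extend {A} {P} {m} g = f , f-spec
  where
  f : ℕ → A
  f i with i ≤? m
  ... | yes i≤m = proj₁ (g i i≤m)
  -- Beyond `m` any value will do; the one at `0` always exists.
  ... | no  _   = proj₁ (g 0 z≤n)
  f-spec : ∀ i → i ≤ m → P i (f i)
  f-spec i i≤m with i ≤? m
  ... | yes i≤m = proj₂ (g i i≤m)
  ... | no  i≰m = contradiction i≤m i≰m

-- Colour the edges of `G` properly for the conflict digraph, whose out-degrees are at most `Δ`. The
-- monochromatic path given by `arrows` then has no conflict between consecutive edges, and
-- `edge-bound` applies to it.
arrows-edge-bound : ∀ {k ℓ m} → 1 ≤ k → ℓ < k → m * (k ∸ ℓ) ≤ k →
  ∀ {r s} .{{_ : NonZero s}} → (let Δ = m * (2 ^ k * (s * 2 ^ k * 2 ^ k))) → Δ + Δ < r →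
  (G : KGraph k) → Arrows G r (pathOrder k ℓ (1 + m)) (pathEdges k ℓ (1 + m)) → s ^ m ≤ edgeCount G
arrows-edge-bound {k} {ℓ} {m} 1≤k ℓ<k md≤k {s = s} 2Δ<r G arrows
  with col , proper ← out-colouring _≟ˢ_ (Conflict.conflicts G s m) _ 2Δ<r _ (E G) ≤-refl (simple G)
         (λ {e} e∈E → Conflict.length-conflicts G s m {e} (All.lookup (uniform G) e∈E))
  with φ , φ-injective , c , copies ← arrows col
  with f , f-spec ← extend (λ i i≤m → All.lookup (Allₚ.map⁻ copies) (∈-upTo⁺ (s≤s i≤m)))
  = edge-bound f (λ i i≤m → proj₁ (f-spec i i≤m)) persistent free
  where
  open Conflict G s m
  d = k ∸ ℓ
  N = pathOrder k ℓ (1 + m)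

  -- A vertex new in path edge `suc i` has position at least `i * d + k`, hence at least `m * d`,
  -- where the last edge starts. So every later edge has started by then, and none ends before edge
  -- `suc i` does.
  persistent : ∀ i t {x} → i + suc t ≤ m → x ∈ f (suc i) → ¬ x ∈ f i → x ∈ f (i + suc t)
  persistent i t {x} i+t≤m x∈ x∉
    with f-spec i (≤-trans (m≤m+n i _) i+t≤m) | f-spec (i + suc t) i+t≤m
       | f-spec (suc i) (≤-trans (subst (suc i ≤_) (sym (+-suc i t)) (s≤s (m≤m+n i t))) i+t≤m)
  ... | _ , image , _ | _ , image″ , _ | _ , image′ , _
    with v , v∈ , refl ← proj₁ (image′ x) x∈
    with lower , upper ← ∈-pathEdge⁻ k ℓ N (suc i) v∈
    with toℕ v <? i * d + k
  ... | yes v<  = contradiction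
    (proj₂ (image x) (v , ∈-pathEdge⁺ k ℓ N i (≤-trans (m≤n+m (i * d) d) lower) v< , refl)) x∉
  ... | no  v≮  = proj₂ (image″ x) (v , ∈-pathEdge⁺ k ℓ N (i + suc t)
    (≤-trans (*-monoˡ-≤ d i+t≤m) (≤-trans md≤k (≤-trans (m≤n+m k (i * d)) (≮⇒≥ v≮))))
    (<-≤-trans upper (+-monoˡ-≤ k (*-monoˡ-≤ d
      (subst (suc i ≤_) (sym (+-suc i t)) (s≤s (m≤m+n i t)))))) , refl)

  first : ∀ {i} → i < m → Σ (Fin N) λ v → toℕ v ≡ i * d
  first {i} i<m = Fin.fromℕ< id<N , Finₚ.toℕ-fromℕ< id<N
    where
    id<N : i * d < N
    id<N = +-mono-≤ 1≤k (*-monoˡ-≤ d (<⇒≤ i<m))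

  -- A conflict list may contain the edge itself, and `proper` separates only distinct edges. The
  -- first vertex of path edge `i` is missing from the next edge, and injectivity of `φ` carries
  -- this over to `G`.
  distinct : ∀ i → i < m → f i ≢ f (suc i)
  distinct i i<m fi≡ with f-spec i (<⇒≤ i<m) | f-spec (suc i) i<m | first i<m
  ... | _ , image , _ | _ , image′ , _ | u , toℕ-u
    with v , v∈ , φv≡ ← proj₁ (image′ _) (subst (φ u ∈_) fi≡ (proj₂ (image _)
           (u , ∈-pathEdge⁺ k ℓ N i (≤-reflexive (sym toℕ-u))
                  (subst (_< i * d + k) (sym toℕ-u) (m<m+n (i * d) 1≤k)) , refl)))
    with refl ← φ-injective φv≡
    = <⇒≱ (m<n+m (i * d) (m<n⇒0<n∸m ℓ<k)) (subst (suc i * d ≤_) toℕ-u (proj₁ (∈-pathEdge⁻ k ℓ N (suc i) v∈)))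

  free : ∀ i → i < m → ¬ f (suc i) ∈ₗ conflicts (f i)
  free i i<m conflict with f-spec i (<⇒≤ i<m) | f-spec (suc i) i<m
  ... | f∈ , _ , col≡c | f′∈ , _ , col′≡c =
    proper f∈ f′∈ conflict (distinct i i<m) (trans col≡c (sym col′≡c))

lookup-ext : ∀ {A : Set} {n} {xs ys : Vec A n} → (∀ i → lookup xs i ≡ lookup ys i) → xs ≡ ys
lookup-ext {xs = xs} {ys} eq =
  trans (sym (Vecₚ.tabulate∘lookup xs)) (trans (Vecₚ.tabulate-cong eq) (Vecₚ.tabulate∘lookup ys))

tabulate-injective : ∀ {A : Set} {n} {f g : Fin n → A} → tabulate f ≡ tabulate g → ∀ i → f i ≡ g i
tabulate-injective {f = f} {g} eq i = trans (sym (Vecₚ.lookup∘tabulate f i))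
  (trans (cong (λ xs → lookup xs i) eq) (Vecₚ.lookup∘tabulate g i))

-- Colourings of the grid [N]^m

-- The tuple after `i` steps on the way from `a` to `b`, when coordinates are replaced in increasing
-- order.
mix : ∀ {A : Set} {m} → ℕ → Vec A m → Vec A m → Vec A m
mix i a b = tabulate λ j → if does (toℕ j <? i) then lookup b j else lookup a j

module _ {A : Set} {m : ℕ} where

  lookup-mix-< : ∀ {i} {a b : Vec A m} {j} → toℕ j < i → lookup (mix i a b) j ≡ lookup b j
  lookup-mix-< {i} {a} {b} {j} j<i = trans (Vecₚ.lookup∘tabulate _ j)
    (cong (if_then lookup b j else lookup a j) (dec-true (toℕ j <? i) j<i))

  lookup-mix-≥ : ∀ {i} {a b : Vec A m} {j} → i ≤ toℕ j → lookup (mix i a b) j ≡ lookup a j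
  lookup-mix-≥ {i} {a} {b} {j} i≤j = trans (Vecₚ.lookup∘tabulate _ j)
    (cong (if_then lookup b j else lookup a j) (dec-false (toℕ j <? i) (≤⇒≯ i≤j)))

module Grid {r N m : ℕ} (χ : Vec (Fin N) m → Fin r) where

  Tuple = Vec (Fin N) m

  -- Steps are read backwards: `v` is the earlier value of coordinate `j`, and `P` is asked of the
  -- predecessor of `x`.
  Step : (Tuple → Set) → Fin m → Tuple → Set
  Step P j x = ∃ λ v → v ≢ lookup x j × χ (x [ j ]≔ v) ≡ χ x × P (x [ j ]≔ v)

  -- Reach i x: x is the last vertex of a monochromatic walk that changes the coordinates
  -- 0 , … , i - 1 in this order.
  Reach : ℕ → Tuple → Set
  Reach zero    x = Unit
  Reach (suc i) x = ∃ λ j → toℕ j ≡ i × Step (Reach i) j x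

  step? : ∀ {P : Tuple → Set} → U.Decidable P → ∀ j → U.Decidable (Step P j)
  step? P? j x = Finₚ.any? λ v →
    ¬? (v Finₚ.≟ lookup x j) ×-dec (χ (x [ j ]≔ v) Finₚ.≟ χ x) ×-dec P? (x [ j ]≔ v)

  reach? : ∀ i → U.Decidable (Reach i)
  reach? zero    x = yes tt
  reach? (suc i) x = Finₚ.any? λ j → (toℕ j ≟ i) ×-dec step? (reach? i) j x

  Stuck : Fin m → Tuple → Set
  Stuck j x = Reach (toℕ j) x × ¬ Step (Reach (toℕ j)) j x

  reach⊎stuck : ∀ i → i ≤ m → ∀ x → Reach i x ⊎ ∃ λ j → Stuck j x
  reach⊎stuck zero    _   x = inj₁ tt
  reach⊎stuck (suc i) i<m x with reach⊎stuck i (<⇒≤ i<m) x | reach? (suc i) x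
  ... | inj₂ stuck | _         = inj₂ stuck
  ... | inj₁ _     | yes reach = inj₁ reach
  -- `Reach (suc i)` amounts to a step at the coordinate of index `i`, so its failure is what
  -- `Stuck` requires.
  ... | inj₁ reach | no ¬step  with Fin.fromℕ< i<m | Finₚ.toℕ-fromℕ< i<m
  ...   | j | refl = inj₂ (j , reach , λ step → ¬step (j , refl , step))

  -- Each coordinate changes at most once and in a fixed order, so the two endpoints determine the
  -- walk and every intermediate tuple is a `mix` of them.
  record Walk (i : ℕ) (x : Tuple) : Set where
    field
      start   : Tuple
      changed : ∀ j → toℕ j < i → lookup start j ≢ lookup x j
      kept    : ∀ j → i ≤ toℕ j → lookup start j ≡ lookup x j
      mono    : ∀ i′ → i′ ≤ i → χ (mix i′ start x) ≡ χ x

  -- The start is kept. Up to stage `toℕ j`, coordinate `j` is still read from `start`, so the mixed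
  -- tuples are those of the shorter walk; at stage `suc (toℕ j)` the mixed tuple is `x`.
  extend-walk : ∀ {i} j {x v} → toℕ j ≡ i → v ≢ lookup x j → χ (x [ j ]≔ v) ≡ χ x →
    Walk i (x [ j ]≔ v) → Walk (suc i) x
  extend-walk j {x} {v} refl v≢ χ≡ w = record
    { start = start ; changed = changed′ ; kept = kept′ ; mono = mono′ }
    where
    open Walk w
    kept′ : ∀ l → toℕ j < toℕ l → lookup start l ≡ lookup x l
    kept′ l j<l = trans (kept l (<⇒≤ j<l)) (Vecₚ.lookup∘update′ (>⇒≢ j<l ∘ cong toℕ) x v)
    changed′ : ∀ l → toℕ l < suc (toℕ j) → lookup start l ≢ lookup x l
    changed′ l l≤j with l Finₚ.≟ j
    ... | yes refl = v≢ ∘ trans (sym (trans (kept j ≤-refl) (Vecₚ.lookup∘update j x v)))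
    ... | no  l≢j  = changed l (≤∧≢⇒< (≤-pred l≤j) (l≢j ∘ Finₚ.toℕ-injective))
                     ∘ (λ eq → trans eq (sym (Vecₚ.lookup∘update′ l≢j x v)))
    mono′ : ∀ i′ → i′ ≤ suc (toℕ j) → χ (mix i′ start x) ≡ χ x
    mono′ i′ i′≤ with i′ ≤? toℕ j
    ... | yes i′≤j = trans (cong χ (lookup-ext same)) (trans (mono i′ i′≤j) χ≡)
      where
      same : ∀ l → lookup (mix i′ start x) l ≡ lookup (mix i′ start (x [ j ]≔ v)) l
      same l with toℕ l <? i′
      ... | yes l<i′ = trans (lookup-mix-< {a = start} {x} l<i′) (trans
              (sym (Vecₚ.lookup∘update′ (λ l≡j → <⇒≢ (<-≤-trans l<i′ i′≤j) (cong toℕ l≡j)) x v))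
              (sym (lookup-mix-< {a = start} {x [ j ]≔ v} l<i′)))
      ... | no  l≮i′ = trans (lookup-mix-≥ {a = start} {x} (≮⇒≥ l≮i′))
              (sym (lookup-mix-≥ {a = start} {x [ j ]≔ v} (≮⇒≥ l≮i′)))
    ... | no  i′≰j = cong χ (lookup-ext same)
      where
      same : ∀ l → lookup (mix i′ start x) l ≡ lookup x l
      same l with toℕ l <? i′
      ... | yes l<i′ = lookup-mix-< {a = start} {x} l<i′
      ... | no  l≮i′ = trans (lookup-mix-≥ {a = start} {x} (≮⇒≥ l≮i′))
              (kept′ l (<-≤-trans (≰⇒> i′≰j) (≮⇒≥ l≮i′)))

  walk : ∀ i x → Reach i x → Walk i x
  walk zero    x _ = record
    { start   = x
    ; changed = λ _ ()
    ; kept    = λ _ _ → refl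
    ; mono    = λ { .0 z≤n → cong χ (lookup-ext λ j → lookup-mix-≥ {a = x} {x} {j} z≤n) }
    }
  walk (suc i) x (j , j≡i , v , v≢ , χ≡ , reach) = extend-walk j j≡i v≢ χ≡ (walk i _ reach)

-- Enumerating the grid, and the pigeonhole argument for walks

tuple : ∀ {N} m → Fin (N ^ m) → Vec (Fin N) m
tuple m u = tabulate (finToFun u)

funToFin-cong : ∀ {m n} {f g : Fin m → Fin n} → (∀ i → f i ≡ g i) → funToFin f ≡ funToFin g
funToFin-cong {zero}  f≗g = refl
funToFin-cong {suc m} f≗g = cong₂ combine (f≗g Fin.zero) (funToFin-cong (f≗g ∘ Fin.suc))

tuple-injective : ∀ {N} m {u v : Fin (N ^ m)} → tuple m u ≡ tuple m v → u ≡ v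
tuple-injective m {u} {v} eq = begin
  u                               ≡⟨ Finₚ.funToFin-finToFin {m} u ⟨
  funToFin (finToFun {n = m} u)   ≡⟨ funToFin-cong (tabulate-injective eq) ⟩
  funToFin (finToFun {n = m} v)   ≡⟨ Finₚ.funToFin-finToFin {m} v ⟩
  v                               ∎
  where open ≡-Reasoning

funToFin-injective : ∀ {m n} {f g : Fin m → Fin n} → funToFin f ≡ funToFin g → ∀ i → f i ≡ g i
funToFin-injective {f = f} {g} eq i = trans (sym (Finₚ.finToFun-funToFin f i))
  (trans (cong (λ u → finToFun u i) eq) (Finₚ.finToFun-funToFin g i))

tuple-surjective : ∀ {N} m (x : Vec (Fin N) m) → ∃ λ u → tuple m u ≡ x
tuple-surjective m x = funToFin (lookup x) ,
  trans (Vecₚ.tabulate-cong (Finₚ.finToFun-funToFin (lookup x))) (Vecₚ.tabulate∘lookup x)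

module _ {r N m′ : ℕ} (χ : Vec (Fin N) (suc m′) → Fin r) where

  open Grid χ

  -- Two tuples on a line in direction `j` differ only there, so overwriting coordinate `j` of `x`
  -- by that of `y` yields `y`, which serves as the predecessor.
  line-step : ∀ {P : Tuple → Set} {j} {x y : Tuple} →
    (∀ l → lookup x (punchIn j l) ≡ lookup y (punchIn j l)) →
    x ≢ y → χ x ≡ χ y → P y → Step P j x
  line-step {P} {j} {x} {y} agree x≢y χ≡ Py =
    lookup y j , differ , trans (cong χ moved) (sym χ≡) , subst P (sym moved) Py
    where
    off-j : ∀ {l} → l ≢ j → lookup x l ≡ lookup y l
    off-j l≢j = subst (λ l → lookup x l ≡ lookup y l) (Finₚ.punchIn-punchOut (l≢j ∘ sym)) (agree _)
    moved : x [ j ]≔ lookup y j ≡ y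
    moved = lookup-ext at
      where
      at : ∀ l → lookup (x [ j ]≔ lookup y j) l ≡ lookup y l
      at l with l Finₚ.≟ j
      ... | yes refl = Vecₚ.lookup∘update l x _
      ... | no  l≢j  = trans (Vecₚ.lookup∘update′ l≢j x _) (off-j l≢j)
    differ : lookup y j ≢ lookup x j
    differ eq = x≢y (lookup-ext at)
      where
      at : ∀ l → lookup x l ≡ lookup y l
      at l with l Finₚ.≟ j
      ... | yes refl = sym eq
      ... | no  l≢j  = off-j l≢j

  code : ∀ x → (∃ λ j → Stuck j x) → Fin (r * (suc m′ * N ^ m′))
  code x (j , _) = combine (χ x) (combine j (funToFin (lookup x ∘ punchIn j)))

  -- Of two tuples with the same code, each would be a step for the other.
  code-injective : ∀ {x y} sx sy → code x sx ≡ code y sy → x ≡ y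
  code-injective {x} {y} (j , _ , ¬step) (j′ , reach , _) eq
    with χ≡ , eq′ ← Finₚ.combine-injective (χ x) _ (χ y) _ eq
    with refl , rest≡ ← Finₚ.combine-injective j _ j′ _ eq′
    with Vecₚ.≡-dec Finₚ._≟_ x y
  ... | yes x≡y = x≡y
  ... | no  x≢y = contradiction (line-step (funToFin-injective rest≡) x≢y χ≡ reach) ¬step

grid-walk : ∀ {r m′} (let m = suc m′; N = suc (r * m)) (χ : Vec (Fin N) m → Fin r) →
  ∃ (Grid.Walk χ m)
grid-walk {r} {m′} χ with Finₚ.any? (λ u → Grid.reach? χ (suc m′) (tuple (suc m′) u))
... | yes (u , reach) = tuple (suc m′) u , Grid.walk χ (suc m′) _ reach
... | no  none = contradiction (Finₚ.pigeonhole too-few (λ u → code χ (tuple m u) (stuck u)))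
    λ (u , v , u<v , eq) → Finₚ.<⇒≢ u<v (tuple-injective m (code-injective χ (stuck u) (stuck v) eq))
  where
  open Grid χ
  m = suc m′
  N = suc (r * m)
  stuck : ∀ u → ∃ λ j → Stuck j (tuple m u)
  stuck u with reach⊎stuck m ≤-refl (tuple m u)
  ... | inj₁ reach = contradiction (u , reach) none
  ... | inj₂ st    = st
  -- The summand `1` in `N` makes the number of codes strictly smaller than the number of tuples.
  too-few : r * (m * N ^ m′) < N ^ m
  too-few = begin-strict
    r * (m * N ^ m′)          ≡⟨ *-assoc r m (N ^ m′) ⟨
    r * m * N ^ m′            <⟨ m<n+m _ (m^n>0 N m′) ⟩
    N ^ m′ + r * m * N ^ m′   ∎
    where open ≤-Reasoning

-- The blown-up grid hypergraph

∣++∣ : ∀ {m n} (p : Subset m) (q : Subset n) → ∣ p ++ q ∣ ≡ ∣ p ∣ + ∣ q ∣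
∣++∣ []            q = refl
∣++∣ (inside  ∷ p) q = cong suc (∣++∣ p q)
∣++∣ (outside ∷ p) q = ∣++∣ p q

-- The edge of a tuple x consists of a core of c vertices and, for each coordinate j, of the
-- d copies of the vertex (j , lookup x j).

module Blowup (d c N m : ℕ) where

  block : ∀ {N} → Fin N → Subset (N * d)
  block a = concat (tabulate λ b → replicate d (does (a Finₚ.≟ b)))

  gridEdge : Vec (Fin N) m → Subset (c + m * (N * d))
  gridEdge x = ⊤ {c} ++ concat (map block x)

  core : Fin c → Fin (c + m * (N * d))
  core s = s ↑ˡ _

  cell : Fin m → Fin N → Fin d → Fin (c + m * (N * d))
  cell j a t = c ↑ʳ combine j (combine a t)

  lookup-cell : ∀ (x : Vec (Fin N) m) j a t → lookup (gridEdge x) (cell j a t) ≡ does (lookup x j Finₚ.≟ a)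
  lookup-cell x j a t = begin
    lookup (gridEdge x) (cell j a t)                            ≡⟨ Vecₚ.lookup-++ʳ (⊤ {c}) _ (combine j (combine a t)) ⟩
    lookup (concat (map block x)) (combine j (combine a t))     ≡⟨ Vecₚ.lookup-concat (map block x) j _ ⟩
    lookup (lookup (map block x) j) (combine a t)               ≡⟨ cong (λ b → lookup b (combine a t)) (Vecₚ.lookup-map j block x) ⟩
    lookup (block (lookup x j)) (combine a t)                   ≡⟨ Vecₚ.lookup-concat (tabulate _) a t ⟩
    lookup (lookup (tabulate _) a) t                            ≡⟨ cong (λ b → lookup b t) (Vecₚ.lookup∘tabulate _ a) ⟩
    lookup (replicate d (does (lookup x j Finₚ.≟ a))) t         ≡⟨ Vecₚ.lookup-replicate t _ ⟩
    does (lookup x j Finₚ.≟ a)                                  ∎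
    where open ≡-Reasoning

  core∈ : ∀ (x : Vec (Fin N) m) s → core s ∈ gridEdge x
  core∈ x s = lookup⇒∈ (trans (Vecₚ.lookup-++ˡ (⊤ {c}) _ s) (Vecₚ.lookup-replicate s inside))

  cell∈⁺ : ∀ (x : Vec (Fin N) m) {j a} t → lookup x j ≡ a → cell j a t ∈ gridEdge x
  cell∈⁺ x {j} {a} t eq = lookup⇒∈ (trans (lookup-cell x j a t) (dec-true (lookup x j Finₚ.≟ a) eq))

  cell∈⁻ : ∀ (x : Vec (Fin N) m) {j a} t → cell j a t ∈ gridEdge x → lookup x j ≡ a
  cell∈⁻ x {j} {a} t cell∈ with lookup x j Finₚ.≟ a | trans (sym (lookup-cell x j a t)) (Vecₚ.[]=⇒lookup cell∈)
  ... | yes eq | _ = eq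

  ∣block∣ : ∀ {N} (a : Fin N) → ∣ block a ∣ ≡ d
  ∣block∣ {suc N} Fin.zero    = trans (∣++∣ (⊤ {d}) _) (trans (cong₂ _+_ (∣⊤∣≡n d) (nothing N)) (+-identityʳ d))
    where
    nothing : ∀ N → ∣ concat (tabulate {n = N} λ _ → replicate d outside) ∣ ≡ 0
    nothing zero    = refl
    nothing (suc N) = trans (∣++∣ (replicate d outside) _) (cong₂ _+_ (∣⊥∣≡0 d) (nothing N))
  ∣block∣ {suc N} (Fin.suc a) = trans (∣++∣ (replicate d outside) _) (cong₂ _+_ (∣⊥∣≡0 d) (∣block∣ a))
  ∣gridEdge∣ : ∀ (x : Vec (Fin N) m) → ∣ gridEdge x ∣ ≡ m * d + c
  ∣gridEdge∣ x = trans (∣++∣ (⊤ {c}) _) (trans (cong₂ _+_ (∣⊤∣≡n c) (blocks x)) (+-comm c (m * d)))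
    where
    blocks : ∀ {m} (x : Vec (Fin N) m) → ∣ concat (map block x) ∣ ≡ m * d
    blocks []      = refl
    blocks (a ∷ x) = trans (∣++∣ (block a) _) (cong₂ _+_ (∣block∣ a) (blocks x))

  -- The argument `t` provides a copy of each grid vertex: the cells with this index that lie in an
  -- edge reveal all coordinates of its tuple.
  gridEdge-injective : Fin d → ∀ {x y : Vec (Fin N) m} → gridEdge x ≡ gridEdge y → x ≡ y
  gridEdge-injective t {x = x} {y} eq = lookup-ext λ j →
    sym (cell∈⁻ y t (subst (cell j (lookup x j) t ∈_) eq (cell∈⁺ x t refl)))

  gridGraph : Fin d → KGraph (m * d + c)
  gridGraph t = record
    { n       = c + m * (N * d)
    ; E       = List.map (gridEdge ∘ tuple m) (List.allFin (N ^ m))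
    ; uniform = Allₚ.map⁺ (All.universal (λ u → ∣gridEdge∣ (tuple m u)) _)
    ; simple  = Uniqueₚ.map⁺ (tuple-injective m ∘ gridEdge-injective t) (Uniqueₚ.allFin⁺ (N ^ m))
    }

  edgeCount-gridGraph : ∀ t → edgeCount (gridGraph t) ≡ N ^ m
  edgeCount-gridGraph t = trans (length-map _ (List.allFin (N ^ m))) (length-tabulate id)

  data Vertex : Fin (c + m * (N * d)) → Set where
    isCore : ∀ s → Vertex (core s)
    isCell : ∀ j a t → Vertex (cell j a t)

  vertex : ∀ y → Vertex y
  vertex y with splitAt c y in eq
  ... | inj₁ s rewrite sym (Finₚ.splitAt⁻¹-↑ˡ eq) = isCore s
  ... | inj₂ z rewrite sym (Finₚ.splitAt⁻¹-↑ʳ eq)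
    with j , at , refl ← Finₚ.combine-surjective {m} {N * d} z
    with a , t , refl ← Finₚ.combine-surjective {N} {d} at = isCell j a t

  core-injective : ∀ {s s′} → core s ≡ core s′ → s ≡ s′
  core-injective = Finₚ.↑ˡ-injective (m * (N * d)) _ _

  cell-injective : ∀ {j j′ : Fin m} {a a′ t t′} → cell j a t ≡ cell j′ a′ t′ → j ≡ j′ × a ≡ a′ × t ≡ t′
  cell-injective {j = j} {j′} {a} {a′} {t} {t′} eq
    with j≡ , eq′ ← Finₚ.combine-injective j _ j′ _ (Finₚ.↑ʳ-injective c _ _ eq)
    = j≡ , Finₚ.combine-injective a t a′ t′ eq′

  core≢cell : ∀ {s} {j : Fin m} {a t} → core s ≢ cell j a t
  core≢cell {s = s} {j} {a} {t} eq = <⇒≱ (Finₚ.toℕ<n s) (begin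
    c                                 ≤⟨ m≤m+n c _ ⟩
    c + toℕ (combine j (combine a t)) ≡⟨ Finₚ.toℕ-↑ʳ c _ ⟨
    toℕ (cell j a t)                  ≡⟨ cong toℕ eq ⟨
    toℕ (core s)                      ≡⟨ Finₚ.toℕ-↑ˡ s _ ⟩
    toℕ s                             ∎)
    where open ≤-Reasoning

  -- Position on the path: the first m and the last m segments of length d surround the core.
  data Position : Set where
    left   : Fin m → Fin d → Position
    middle : Fin c → Position
    right  : Fin m → Fin d → Position

  pathLength : ℕ
  pathLength = m * d + c + m * d

  place : Position → Fin (pathLength)
  place (left j t)  = combine j t ↑ˡ c ↑ˡ m * d
  place (middle s)  = (m * d ↑ʳ s) ↑ˡ m * d
  place (right j t) = m * d + c ↑ʳ combine j t

  locate : Fin (pathLength) → Position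
  locate v = [ [ uncurry left ∘ remQuot d , middle ]′ ∘ splitAt (m * d) , uncurry right ∘ remQuot d ]′
    (splitAt (m * d + c) v)

  locate-place : ∀ w → locate (place w) ≡ w
  locate-place (left j t)
    rewrite Finₚ.splitAt-↑ˡ (m * d + c) (combine j t ↑ˡ c) (m * d)
          | Finₚ.splitAt-↑ˡ (m * d) (combine j t) c = cong (uncurry left) (Finₚ.remQuot-combine j t)
  locate-place (middle s)
    rewrite Finₚ.splitAt-↑ˡ (m * d + c) (m * d ↑ʳ s) (m * d)
          | Finₚ.splitAt-↑ʳ (m * d) c s = refl
  locate-place (right j t)
    rewrite Finₚ.splitAt-↑ʳ (m * d + c) (m * d) (combine j t) = cong (uncurry right) (Finₚ.remQuot-combine j t)

  place-surjective : ∀ v → ∃ λ w → place w ≡ v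
  place-surjective v with splitAt (m * d + c) v in eq
  place-surjective v | inj₂ z with j , t , refl ← Finₚ.combine-surjective {m} {d} z =
    right j t , Finₚ.splitAt⁻¹-↑ʳ eq
  place-surjective v | inj₁ z with splitAt (m * d) z in eq′
  ... | inj₂ s = middle s , trans (cong (_↑ˡ m * d) (Finₚ.splitAt⁻¹-↑ʳ eq′)) (Finₚ.splitAt⁻¹-↑ˡ eq)
  ... | inj₁ y with j , t , refl ← Finₚ.combine-surjective {m} {d} y =
    left j t , trans (cong (_↑ˡ m * d) (Finₚ.splitAt⁻¹-↑ˡ eq′)) (Finₚ.splitAt⁻¹-↑ˡ eq)

  toℕ-place : Position → ℕ
  toℕ-place (left j t)  = d * toℕ j + toℕ t
  toℕ-place (middle s)  = m * d + toℕ s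
  toℕ-place (right j t) = m * d + c + (d * toℕ j + toℕ t)

  toℕ-place-≡ : ∀ w → toℕ (place w) ≡ toℕ-place w
  toℕ-place-≡ (left j t)  = trans (Finₚ.toℕ-↑ˡ (combine j t ↑ˡ c) (m * d))
    (trans (Finₚ.toℕ-↑ˡ (combine j t) c) (Finₚ.toℕ-combine j t))
  toℕ-place-≡ (middle s)  = trans (Finₚ.toℕ-↑ˡ (m * d ↑ʳ s) (m * d)) (Finₚ.toℕ-↑ʳ (m * d) s)
  toℕ-place-≡ (right j t) = trans (Finₚ.toℕ-↑ʳ (m * d + c) (combine j t))
    (cong (m * d + c +_) (Finₚ.toℕ-combine j t))

  -- Path edge `i` in terms of segments: its window has dropped the first `i` left segments and
  -- gained the first `i` right ones, while the core stays inside.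
  Covered : ℕ → Position → Set
  Covered i (left j t)  = i ≤ toℕ j
  Covered i (middle s)  = Unit
  Covered i (right j t) = toℕ j < i

  offset-< : ∀ i j (t : Fin d) → j < i → d * j + toℕ t < i * d
  offset-< i j t j<i = begin-strict
    d * j + toℕ t   <⟨ +-monoʳ-< (d * j) (Finₚ.toℕ<n t) ⟩
    d * j + d       ≡⟨ trans (+-comm (d * j) d) (cong (d +_) (*-comm d j)) ⟩
    suc j * d       ≤⟨ *-monoˡ-≤ d j<i ⟩
    i * d           ∎
    where open ≤-Reasoning

  offset-≥ : ∀ i j (t : Fin d) → i ≤ j → i * d ≤ d * j + toℕ t
  offset-≥ i j t i≤j = ≤-trans (≤-trans (*-monoˡ-≤ d i≤j) (≤-reflexive (*-comm j d))) (m≤m+n (d * j) (toℕ t))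

  covered⁺ : ∀ i → i ≤ m → ∀ w → Covered i w →
    i * d ≤ toℕ-place w × toℕ-place w < i * d + (m * d + c)
  covered⁺ i i≤m (left j t) i≤j = offset-≥ i (toℕ j) t i≤j ,
    <-≤-trans (offset-< m (toℕ j) t (Finₚ.toℕ<n j)) (≤-trans (m≤m+n (m * d) c) (m≤n+m _ (i * d)))
  covered⁺ i i≤m (middle s) _ = ≤-trans (*-monoˡ-≤ d i≤m) (m≤m+n (m * d) (toℕ s)) ,
    <-≤-trans (+-monoʳ-< (m * d) (Finₚ.toℕ<n s)) (m≤n+m _ (i * d))
  covered⁺ i i≤m (right j t) j<i =
    ≤-trans (*-monoˡ-≤ d i≤m) (≤-trans (m≤m+n (m * d) c) (m≤m+n (m * d + c) _)) ,
    <-≤-trans (+-monoʳ-< (m * d + c) (offset-< i (toℕ j) t j<i)) (≤-reflexive (+-comm (m * d + c) (i * d)))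

  covered⁻ : ∀ i → ∀ w → i * d ≤ toℕ-place w → toℕ-place w < i * d + (m * d + c) → Covered i w
  covered⁻ i (left j t) lower upper with i ≤? toℕ j
  ... | yes i≤j = i≤j
  ... | no  i≰j = contradiction lower (<⇒≱ (offset-< i (toℕ j) t (≰⇒> i≰j)))
  covered⁻ i (middle s) lower upper = tt
  covered⁻ i (right j t) lower upper with toℕ j <? i
  ... | yes j<i = j<i
  ... | no  j≮i = contradiction upper (≤⇒≯ (≤-trans (≤-reflexive (+-comm (i * d) (m * d + c)))
          (+-monoʳ-≤ (m * d + c) (offset-≥ i (toℕ j) t (≮⇒≥ j≮i)))))

  -- Embedding the path along a walk from `a` to `b`

  module Embedding (a b : Vec (Fin N) m) (a≢b : ∀ j → lookup a j ≢ lookup b j) where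

    -- Left segments carry the old coordinates and right segments the new ones, so the window of
    -- path edge `i` is sent onto the edge of `mix i a b`. The two segments of one coordinate stay
    -- apart because `a` and `b` differ in it.
    embed : Position → Fin (c + m * (N * d))
    embed (left j t)  = cell j (lookup a j) t
    embed (middle s)  = core s
    embed (right j t) = cell j (lookup b j) t

    embed-injective : ∀ v w → embed v ≡ embed w → v ≡ w
    embed-injective (left j t)  (left _ _)  eq with refl , _ , refl ← cell-injective eq = refl
    embed-injective (left j t)  (middle _)  eq = contradiction (sym eq) core≢cell
    embed-injective (left j t)  (right _ _) eq with refl , a≡b , _ ← cell-injective eq = contradiction a≡b (a≢b j)
    embed-injective (middle s)  (left _ _)  eq = contradiction eq core≢cell
    embed-injective (middle s)  (middle _)  eq = cong middle (core-injective eq)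
    embed-injective (middle s)  (right _ _) eq = contradiction eq core≢cell
    embed-injective (right j t) (left _ _)  eq with refl , b≡a , _ ← cell-injective eq = contradiction (sym b≡a) (a≢b j)
    embed-injective (right j t) (middle _)  eq = contradiction (sym eq) core≢cell
    embed-injective (right j t) (right _ _) eq with refl , _ , refl ← cell-injective eq = refl

    φ : Fin (pathLength) → Fin (c + m * (N * d))
    φ = embed ∘ locate

    φ-place : ∀ w → φ (place w) ≡ embed w
    φ-place w = cong embed (locate-place w)

    φ-injective : Injective _≡_ _≡_ φ
    φ-injective {v} {v′} eq with place-surjective v | place-surjective v′
    ... | w , refl | w′ , refl = cong place (embed-injective w w′
      (trans (sym (φ-place w)) (trans eq (φ-place w′))))

    embed∈⁺ : ∀ i w → Covered i w → embed w ∈ gridEdge (mix i a b)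
    embed∈⁺ i (left j t)  i≤j = cell∈⁺ (mix i a b) t (lookup-mix-≥ {a = a} {b} i≤j)
    embed∈⁺ i (middle s)  _   = core∈ (mix i a b) s
    embed∈⁺ i (right j t) j<i = cell∈⁺ (mix i a b) t (lookup-mix-< {a = a} {b} j<i)

    embed∈⁻ : ∀ i {y} → y ∈ gridEdge (mix i a b) → ∃ λ w → Covered i w × embed w ≡ y
    embed∈⁻ i {y} y∈ with vertex y
    ... | isCore s     = middle s , tt , refl
    ... | isCell j x t with cell∈⁻ (mix i a b) t y∈ | toℕ j <? i
    ...   | refl | yes j<i = right j t , j<i , cong (λ x → cell j x t) (sym (lookup-mix-< {a = a} {b} j<i))
    ...   | refl | no  j≮i = left j t , ≮⇒≥ j≮i , cong (λ x → cell j x t) (sym (lookup-mix-≥ {a = a} {b} (≮⇒≥ j≮i)))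

    image : ∀ ℓ → m * d + c ∸ ℓ ≡ d → ∀ i → i ≤ m →
      IsImage φ (pathEdge (m * d + c) ℓ (pathLength) i) (gridEdge (mix i a b))
    image ℓ k∸ℓ≡d i i≤m y = to , from
      where
      k = m * d + c
      edge = pathEdge k ℓ (pathLength) i
      shift : i * (k ∸ ℓ) ≡ i * d
      shift = cong (i *_) k∸ℓ≡d
      to : y ∈ gridEdge (mix i a b) → Σ _ λ v → v ∈ edge × φ v ≡ y
      to y∈ with w , covered , refl ← embed∈⁻ i y∈
        with lower , upper ← covered⁺ i i≤m w covered
        = place w , ∈-pathEdge⁺ k ℓ _ i
            (subst₂ _≤_ (sym shift) (sym (toℕ-place-≡ w)) lower)
            (subst₂ _<_ (sym (toℕ-place-≡ w)) (cong (_+ k) (sym shift)) upper) , φ-place w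
      from : (Σ _ λ v → v ∈ edge × φ v ≡ y) → y ∈ gridEdge (mix i a b)
      from (v , v∈ , refl) with w , refl ← place-surjective v
        with lower , upper ← ∈-pathEdge⁻ k ℓ _ i v∈
        = subst (_∈ gridEdge (mix i a b)) (sym (φ-place w)) (embed∈⁺ i w (covered⁻ i w
            (subst₂ _≤_ shift (toℕ-place-≡ w) lower)
            (subst₂ _<_ (toℕ-place-≡ w) (cong (_+ k) shift) upper)))

-- The upper bound construction

-- Having `k` as a parameter lets the whole statement be transported along `m * d + c ≡ k`.
Arrowing : (k ℓ m r bound : ℕ) → Set
Arrowing k ℓ m r bound = Σ (KGraph k) λ G →
  Arrows G r (pathOrder k ℓ (1 + m)) (pathEdges k ℓ (1 + m)) × edgeCount G ≤ bound

grid-arrows : ∀ d c ℓ m r → Fin d → (let m = suc m; k = m * d + c) → k ∸ ℓ ≡ d →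
  Arrowing k ℓ m r (suc (r * m) ^ m)
grid-arrows d c ℓ m′ r t k∸ℓ≡d = G , arrows , ≤-reflexive (edgeCount-gridGraph t)
  where
  m = suc m′
  k = m * d + c
  N = suc (r * m)
  open Blowup d c N m
  G = gridGraph t
  arrows′ : (col : Subset (n G) → Fin r) →
    MonoCopy G r col pathLength (List.map (pathEdge k ℓ pathLength) (List.upTo (1 + m)))
  -- The common colour is that of the final tuple `b`, to which `mono` compares every stage of the
  -- walk.
  arrows′ col with b , w ← grid-walk (col ∘ gridEdge) = φ , φ-injective , col (gridEdge b) ,
    Allₚ.map⁺ (All.tabulate λ {i} i∈ → gridEdge (mix i start b) , edge∈ (mix i start b) ,
      image ℓ k∸ℓ≡d i (≤-pred (∈-upTo⁻ i∈)) , mono i (≤-pred (∈-upTo⁻ i∈)))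
    where
    open Grid.Walk w
    open Embedding start b (λ j → changed j (Finₚ.toℕ<n j))
    edge∈ : ∀ x → gridEdge x ∈ₗ E G
    edge∈ x with u , refl ← tuple-surjective m x = ∈-map⁺ (gridEdge ∘ tuple m) (∈-allFin u)
  arrows : Arrows G r (pathOrder k ℓ (1 + m)) (pathEdges k ℓ (1 + m))
  -- `pathOrder` contains `k ∸ ℓ` where `pathLength` has `d`; the type of the edges depends on it,
  -- so both are transported together.
  arrows = subst (λ p → Arrows G r p (List.map (pathEdge k ℓ p) (List.upTo (1 + m))))
    (cong (λ d → k + m * d) (sym k∸ℓ≡d)) arrows′

-- Choice of constants

*-^ : ∀ a b m → (a * b) ^ m ≡ a ^ m * b ^ m
*-^ a b zero    = refl
*-^ a b (suc m) = trans (cong (a * b *_) (*-^ a b m)) (swap a b (a ^ m) (b ^ m))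
  where
  swap : ∀ a b c d → a * b * (c * d) ≡ a * c * (b * d)
  swap = solve-∀

-- Used for both bounds: with `b` the quotient `r / K` for the lower one, and to compare
-- `suc (r * m) ^ m` with `r ^ m` for the upper one.
power-bound : ∀ {a b r E} m → r ≤ a * b → b ^ m ≤ E → r ^ m ≤ a ^ m * E
power-bound {a} {b} {r} {E} m r≤ab bᵐ≤E = begin
  r ^ m          ≤⟨ ^-monoˡ-≤ m r≤ab ⟩
  (a * b) ^ m    ≡⟨ *-^ a b m ⟩
  a ^ m * b ^ m  ≤⟨ *-monoʳ-≤ (a ^ m) bᵐ≤E ⟩
  a ^ m * E      ∎
  where open ≤-Reasoning

-- As `K ≤ r`, the quotient is positive, so the remainder, being below `K`, is at most one further
-- `r / K * K`.
≤2*quotient : ∀ r K .{{_ : NonZero K}} → K ≤ r → r ≤ 2 * K * (r / K)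
≤2*quotient r K K≤r = begin
  r                        ≡⟨ m≡m%n+[m/n]*n r K ⟩
  r % K + r / K * K        ≤⟨ +-monoˡ-≤ _ (<⇒≤ (m%n<n r K)) ⟩
  K + r / K * K            ≤⟨ +-monoˡ-≤ _ (m≤n*m K (r / K) {{>-nonZero (m≥n⇒m/n>0 K≤r)}}) ⟩
  r / K * K + r / K * K    ≡⟨ double (r / K) K ⟩
  2 * K * (r / K)          ∎
  where
  open ≤-Reasoning
  double : ∀ q K → q * K + q * K ≡ 2 * K * q
  double = solve-∀

theorem1p3 : (k ℓ m : ℕ) → 2 ≤ k → 1 ≤ ℓ → ℓ ≤ k ∸ 1 → 1 ≤ m → m * (k ∸ ℓ) ≤ k →
    Σ ℕ λ b → Σ ℕ λ C → Σ ℕ λ r₀ → 1 ≤ b × 1 ≤ C ×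
    ((r : ℕ) → r₀ ≤ r →
    ((G : KGraph k) → Arrows G r (pathOrder k ℓ (1 + m)) (pathEdges k ℓ (1 + m)) →
    r ^ m ≤ b * edgeCount G)
    × (Σ (KGraph k) λ G → Arrows G r (pathOrder k ℓ (1 + m)) (pathEdges k ℓ (1 + m))
    × edgeCount G ≤ C * r ^ m))
theorem1p3 k@(suc _) ℓ m@(suc m′) _ _ ℓ≤k∸1 _ md≤k =
  (2 * K) ^ m , suc m ^ m , K , m^n>0 (2 * K) m , m^n>0 (suc m) m ,
  λ r K≤r → lower r K≤r , upper r (≤-trans z<s K≤r)
  where
  -- `w * s` is the bound on the conflicts of an edge. As `K` exceeds `w + w`, the choice
  -- `s = r / K` leaves twice that bound below `r`, and `K ≤ r` makes `s` positive.
  w = m * (2 ^ k * (2 ^ k * 2 ^ k))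
  K = suc (w + w)

  lower : ∀ r → K ≤ r → (G : KGraph k) → Arrows G r (pathOrder k ℓ (1 + m)) (pathEdges k ℓ (1 + m)) →
    r ^ m ≤ (2 * K) ^ m * edgeCount G
  lower r K≤r G arrows = power-bound m (≤2*quotient r K K≤r)
    (arrows-edge-bound {m = m} z<s (s≤s ℓ≤k∸1) md≤k {{>-nonZero s>0}} few-conflicts G arrows)
    where
    s = r / K
    s>0 : 0 < s
    s>0 = m≥n⇒m/n>0 K≤r
    collect : ∀ m p s → m * (p * (s * p * p)) + m * (p * (s * p * p)) ≡
      (m * (p * (p * p)) + m * (p * (p * p))) * s
    collect = solve-∀
    few-conflicts : m * (2 ^ k * (s * 2 ^ k * 2 ^ k)) + m * (2 ^ k * (s * 2 ^ k * 2 ^ k)) < r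
    few-conflicts = begin-strict
      m * (2 ^ k * (s * 2 ^ k * 2 ^ k)) + m * (2 ^ k * (s * 2 ^ k * 2 ^ k)) ≡⟨ collect m (2 ^ k) s ⟩
      (w + w) * s        <⟨ m<n+m _ s>0 ⟩
      K * s              ≡⟨ *-comm K s ⟩
      s * K              ≤⟨ m/n*n≤m r K ⟩
      r                  ∎
      where open ≤-Reasoning

  upper : ∀ r → 0 < r → Arrowing k ℓ m r (suc m ^ m * r ^ m)
  upper r r>0 = map₂ (map₂ (λ ≤N^m → ≤-trans ≤N^m (power-bound {suc m} {r} m N≤ ≤-refl)))
    (subst (λ k′ → Arrowing k′ ℓ m r (suc (r * m) ^ m)) k≡
      (grid-arrows d c ℓ m′ r (Fin.fromℕ< (m<n⇒0<n∸m (s≤s ℓ≤k∸1))) (cong (_∸ ℓ) k≡)))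
    where
    d = k ∸ ℓ
    -- The number of vertices common to all `m + 1` edges of the path, possibly zero.
    c = k ∸ m * d
    k≡ : m * d + c ≡ k
    k≡ = m+[n∸m]≡n md≤k
    N≤ : suc (r * m) ≤ suc m * r
    N≤ = ≤-trans (+-monoˡ-≤ (r * m) r>0) (≤-reflexive (cong (r +_) (*-comm r m)))
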